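{- For all positive integers $a,b$, the Aztec rectangle $\mathcal{AR}_{a,b}$ (with no defects) has a cover by L-trominoes if and only if $a(b+1)+b(a+1)\equiv 0 \pmod 3$.
   Context: A cell is a unit square $[i,i+1]\times[j,j+1]$ with $i,j\in\mathbb{Z}$, labelled by its coordinate $(i,j)$. A region is a finite set of cells whose union is connected (cells sharing an edge are adjacent). An L-tromino is a set of three cells equal to a $2\times 2$ block of cells with one cell removed, i.e. a translate of one of $\{(0,0),(1,0),(0,1)\}$, $\{(0,0),(1,0),(1,1)\}$, $\{(0,0),(0,1),(1,1)\}$, $\{(1,0),(0,1),(1,1)\}$. Some cells of a region may be designated as defects. A cover (tiling) of a region $R$ with defect set $D\subseteq R$ is a set of pairwise disjoint L-trominoes, each contained in $R\setminus D$, whose union is exactly $R\setminus D$. For positive integers $a,b$, the Aztec rectangle $\mathcal{AR}_{a,b}$ is (up to translation) the region consisting of the cells $(i,j)\in\mathbb{Z}^2$ with $0\le i+j\le 2b$ and $1\le j-i\le 2a+1$; it has $a$ cells along its southwestern side, $b$ cells along its northwestern side, and $a(b+1)+b(a+1)$ cells in total. -}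

module Defs where

open import Data.Integer using (ℤ; +_; 0ℤ; 1ℤ; _+_; _-_; _≤_)
open import Data.List using (List; []; _∷_; map)
open import Data.List.Membership.Propositional using () renaming (_∈_ to _∈ₗ_)
open import Data.List.Relation.Unary.All using (All)
open import Data.List.Relation.Unary.AllPairs using (AllPairs)
open import Data.List.Relation.Unary.Any using (Any)
open import Data.Nat using (ℕ) renaming (_+_ to _+ℕ_; _*_ to _*ℕ_)
open import Data.Product using (_×_; _,_; ∃)
open import Level using (0ℓ)
open import Relation.Unary using (Pred; _∈_; _⊆_; _≐_; _∖_; _⊥_)

Cell : Set
Cell = ℤ × ℤ

CellSet : Set₁
CellSet = Pred Cell 0ℓ

translate : Cell → Cell → Cell
translate (x , y) (i , j) = (x + i , y + j)

-- A shape is named after the cell removed from the block {0,1} × {0,1}.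
data Shape : Set where
  without-11 without-01 without-10 without-00 : Shape

shapeCells : Shape → List Cell
shapeCells without-11 = (0ℤ , 0ℤ) ∷ (1ℤ , 0ℤ) ∷ (0ℤ , 1ℤ) ∷ []
shapeCells without-01 = (0ℤ , 0ℤ) ∷ (1ℤ , 0ℤ) ∷ (1ℤ , 1ℤ) ∷ []
shapeCells without-10 = (0ℤ , 0ℤ) ∷ (0ℤ , 1ℤ) ∷ (1ℤ , 1ℤ) ∷ []
shapeCells without-00 = (1ℤ , 0ℤ) ∷ (0ℤ , 1ℤ) ∷ (1ℤ , 1ℤ) ∷ []

-- Distinct (shape , offset) pairs give distinct sets of cells, so this type
-- is in bijection with the L-trominoes in the plane.
record LTromino : Set where
  constructor tromino
  field
    shape  : Shape
    offset : Cell

⟦_⟧ : LTromino → CellSet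
⟦ tromino s v ⟧ c = c ∈ₗ map (translate v) (shapeCells s)

-- Regions are finite, so a set of pairwise disjoint trominoes inside one is
-- finite and can be listed; disjointness rules out repetitions in the list.
record IsCover (R D : CellSet) (ts : List LTromino) : Set where
  field
    disjoint  : AllPairs (λ s t → ⟦ s ⟧ ⊥ ⟦ t ⟧) ts
    contained : All (λ t → ⟦ t ⟧ ⊆ R ∖ D) ts
    union     : (λ c → Any (λ t → c ∈ ⟦ t ⟧) ts) ≐ R ∖ D

HasCover : (R D : CellSet) → Set
HasCover R D = ∃ (IsCover R D)

AztecRectangle : (a b : ℕ) → CellSet
AztecRectangle a b (i , j) =
  (0ℤ ≤ i + j × i + j ≤ + (2 *ℕ b)) ×
  (1ℤ ≤ j - i × j - i ≤ + (2 *ℕ a +ℕ 1))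

{-# OPTIONS --safe #-}

-- In the diagonal coordinates s = i + j and d = j − i the Aztec rectangle is the
-- box [0,2b] × [1,2a+1], restricted to the points (s,d) with s ≡ d (mod 2), and
-- the cells in any 2 × 3 or 3 × 2 box form an L-tromino. A cover exists only if 3
-- divides the number of cells, that is, only if a ≡ b ≡ 0 or a ≡ b ≡ 2 (mod 3).
-- In these cases a pinwheel of four boxes around a single point with s ≢ d
-- splits the rectangle into boxes with one side divisible by 2 and the other by 3.
module Submission where

open import Defs
open import Algebra.Bundles using (AbelianGroup)
open import Data.Empty using (⊥-elim)
open import Data.Fin using (Fin; zero; suc; toℕ)
open import Data.Integer as ℤ using (ℤ; +_; -[1+_]; 0ℤ; 1ℤ; -1ℤ)
import Data.Integer.Properties as ℤ
open import Data.Integer.Tactic.RingSolver using () renaming (solve-∀ to ℤ-solve-∀)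
open import Data.List using (List; []; _∷_; _++_; map; length; concatMap; cartesianProductWith; upTo)
open import Data.List.Membership.Propositional using () renaming (_∈_ to _∈ₗ_)
open import Data.List.Membership.Propositional.Properties
  using (∈-map⁺; ∈-map⁻; ∈-++⁺ˡ; ∈-++⁺ʳ; ∈-++⁻; ∈-concatMap⁺; ∈-concatMap⁻;
         ∈-cartesianProductWith⁺; ∈-cartesianProductWith⁻; ∈-upTo⁺; ∈-upTo⁻)
open import Data.List.Membership.Propositional.Properties.WithK using (unique∧set⇒bag)
open import Data.List.Properties using (length-++; length-map; length-upTo)
open import Data.List.Relation.Binary.BagAndSetEquality using (∼bag⇒↭)
open import Data.List.Relation.Binary.Permutation.Propositional.Properties using (↭-length)
open import Data.List.Relation.Unary.All as All using (All; []; _∷_; all?)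
import Data.List.Relation.Unary.All.Properties as All
open import Data.List.Relation.Unary.AllPairs as AllPairs using ([]; _∷_)
import Data.List.Relation.Unary.AllPairs.Properties as AllPairs
open import Data.List.Relation.Unary.Any as Any using (Any; here; there)
import Data.List.Relation.Unary.Any.Properties as Any
open import Data.List.Relation.Unary.Unique.Propositional using (Unique)
import Data.List.Relation.Unary.Unique.Propositional.Properties as Unique
open import Data.Nat using (ℕ; zero; suc; _+_; _*_; _%_; NonZero; z≤n; s≤s; ≢-nonZero⁻¹)
open import Data.Nat.DivMod using (DivMod; _divMod_; result; [m+kn]%n≡m%n; m*n%n≡0)
import Data.Nat.Properties as ℕ
open import Data.Nat.Tactic.RingSolver using () renaming (solve-∀ to ℕ-solve-∀)
open import Data.Product using (_×_; _,_; proj₁; proj₂; ∃)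
open import Data.Product.Properties using (≡-dec)
open import Data.Sum using (_⊎_; inj₁; inj₂; [_,_]′)
open import Function using (_∘_)
open import Function.Bundles using (_⇔_; mk⇔; Equivalence)
open import Relation.Binary.PropositionalEquality
  using (_≡_; refl; sym; trans; cong; cong₂; subst; subst₂)
open import Relation.Nullary using (¬_; yes; no; contradiction)
open import Relation.Nullary.Decidable using (map′; _×-dec_; _→-dec_; from-yes)
open import Relation.Unary using (∅; Decidable; _∈_; _⊆_; _≐_; _∪_; _⊥_)

-- Inequalities between integers

-- Turns a linear inequality into an identity between differences, which the ring solver can prove.
≤-diff : ∀ {a b c d} → a ℤ.≤ b → d ℤ.- c ≡ b ℤ.- a → c ℤ.≤ d
≤-diff a≤b eq = ℤ.0≤i-j⇒j≤i (subst (0ℤ ℤ.≤_) (sym eq) (ℤ.i≤j⇒0≤j-i a≤b))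

<-diff : ∀ {a b c d} → a ℤ.< b → d ℤ.- c ≡ b ℤ.- a → c ℤ.< d
<-diff {a} {b} {c} {d} a<b eq = ℤ.suc[i]≤j⇒i<j (≤-diff (ℤ.i<j⇒suc[i]≤j a<b) eq′)
  where
  pull : ∀ x y → y ℤ.- (1ℤ ℤ.+ x) ≡ (y ℤ.- x) ℤ.- 1ℤ
  pull = ℤ-solve-∀
  eq′ : d ℤ.- (1ℤ ℤ.+ c) ≡ b ℤ.- (1ℤ ℤ.+ a)
  eq′ = trans (pull c d) (trans (cong (ℤ._- 1ℤ) eq) (sym (pull a b)))

-- If b < a, then 2a ≥ 2b + 2. The slack of 1 allows bounds to be halved whatever their parity.
half-≤ : ∀ {a b} → a ℤ.+ a ℤ.≤ 1ℤ ℤ.+ (b ℤ.+ b) → a ℤ.≤ b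
half-≤ {a} {b} 2a≤1+2b = ℤ.≮⇒≥ λ b<a →
  let 1+b≤a = ℤ.i<j⇒suc[i]≤j b<a in
  contradiction
    (≤-diff {c = 1ℤ} {d = 0ℤ} (ℤ.≤-trans (ℤ.+-mono-≤ 1+b≤a 1+b≤a) 2a≤1+2b) (eq b))
    λ { (ℤ.+≤+ ()) }
  where
  eq : ∀ b → 0ℤ ℤ.- 1ℤ ≡ (1ℤ ℤ.+ (b ℤ.+ b)) ℤ.- ((1ℤ ℤ.+ b) ℤ.+ (1ℤ ℤ.+ b))
  eq = ℤ-solve-∀

double-injective : ∀ {a b} → a ℤ.+ a ≡ b ℤ.+ b → a ≡ b
double-injective 2a≡2b = ℤ.≤-antisym
  (half-≤ (ℤ.i≤j⇒i≤k+j 1ℤ (ℤ.≤-reflexive 2a≡2b)))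
  (half-≤ (ℤ.i≤j⇒i≤k+j 1ℤ (ℤ.≤-reflexive (sym 2a≡2b))))

odd≢even : ∀ a b → ¬ 1ℤ ℤ.+ (a ℤ.+ a) ≡ b ℤ.+ b
-- Halving the equation in both directions gives a + 1 ≤ b and b ≤ a.
odd≢even a b odd≡even = ℤ.i≢suc[i] (ℤ.≤-antisym (ℤ.i≤suc[i] a) (ℤ.≤-trans
  (half-≤ {ℤ.suc a} {b} (≤-diff (ℤ.≤-reflexive odd≡even) (eq a b)))
  (half-≤ (ℤ.≤-reflexive (sym odd≡even)))))
  where
  eq : ∀ a b → 1ℤ ℤ.+ (b ℤ.+ b) ℤ.- ((1ℤ ℤ.+ a) ℤ.+ (1ℤ ℤ.+ a)) ≡
       (b ℤ.+ b) ℤ.- (1ℤ ℤ.+ (a ℤ.+ a))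
  eq = ℤ-solve-∀

parity : ∀ i → ∃ λ h → i ≡ h ℤ.+ h ⊎ i ≡ 1ℤ ℤ.+ (h ℤ.+ h)
parity (+ zero) = 0ℤ , inj₁ refl
parity (+ suc n) with parity (+ n)
... | h , inj₁ eq = h , inj₂ (cong ℤ.suc eq)
... | h , inj₂ eq = ℤ.suc h , inj₁ (trans (cong ℤ.suc eq) (step h))
  where
  step : ∀ h → 1ℤ ℤ.+ (1ℤ ℤ.+ (h ℤ.+ h)) ≡ (1ℤ ℤ.+ h) ℤ.+ (1ℤ ℤ.+ h)
  step = ℤ-solve-∀
-- Here -1 = 1 + 2 · (-1), so the half is rounded down.
parity -[1+ zero ] = -1ℤ , inj₂ refl
parity -[1+ suc n ] with parity -[1+ n ]
... | h , inj₁ eq = ℤ.pred h , inj₂ (trans (cong ℤ.pred eq) (step h))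
  where
  step : ∀ h → -1ℤ ℤ.+ (h ℤ.+ h) ≡ 1ℤ ℤ.+ ((-1ℤ ℤ.+ h) ℤ.+ (-1ℤ ℤ.+ h))
  step = ℤ-solve-∀
... | h , inj₂ eq = h , inj₁ (trans (cong ℤ.pred eq) (step h))
  where
  step : ∀ h → -1ℤ ℤ.+ (1ℤ ℤ.+ (h ℤ.+ h)) ≡ h ℤ.+ h
  step = ℤ-solve-∀

0≤i≤1⇒i≡0∨i≡1 : ∀ {i} → 0ℤ ℤ.≤ i → i ℤ.≤ 1ℤ → i ≡ 0ℤ ⊎ i ≡ 1ℤ
0≤i≤1⇒i≡0∨i≡1 (ℤ.+≤+ _) (ℤ.+≤+ z≤n)       = inj₁ refl
0≤i≤1⇒i≡0∨i≡1 (ℤ.+≤+ _) (ℤ.+≤+ (s≤s z≤n)) = inj₂ refl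

-- Covers of regions without defects

cover-resp-≐ : ∀ {R S} → R ≐ S → HasCover R ∅ → HasCover S ∅
cover-resp-≐ (R⊆S , S⊆R) (ts , cov) = ts , record
  { disjoint  = disjoint
  ; contained = All.map (λ t⊆R {c} c∈t → R⊆S (proj₁ (t⊆R c∈t)) , λ ()) contained
  ; union     = (λ c∈ts → R⊆S (proj₁ (proj₁ union c∈ts)) , λ ())
              , (λ (c∈S , _) → proj₂ union (S⊆R c∈S , λ ()))
  }
  where open IsCover cov

cover-∪ : ∀ {R S} → R ⊥ S → HasCover R ∅ → HasCover S ∅ → HasCover (R ∪ S) ∅
cover-∪ {R} {S} R⊥S (ts , covR) (us , covS) = ts ++ us , record
  { disjoint  = AllPairs.++⁺ R.disjoint S.disjoint
      (All.map (λ t⊆R → All.map (λ u⊆S {c} (c∈t , c∈u) →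
        R⊥S (proj₁ (t⊆R c∈t) , proj₁ (u⊆S c∈u))) S.contained) R.contained)
  ; contained = All.++⁺
      (All.map (λ t⊆R {c} c∈t → inj₁ (proj₁ (t⊆R c∈t)) , λ ()) R.contained)
      (All.map (λ u⊆S {c} c∈u → inj₂ (proj₁ (u⊆S c∈u)) , λ ()) S.contained)
  ; union     = (λ c∈ → [ (λ c∈ts → inj₁ (proj₁ (proj₁ R.union c∈ts)))
                        , (λ c∈us → inj₂ (proj₁ (proj₁ S.union c∈us))) ]′
                        (Any.++⁻ ts c∈) , λ ())
              , λ { (inj₁ c∈R , _) → Any.++⁺ˡ (proj₂ R.union (c∈R , λ ()))
                  ; (inj₂ c∈S , _) → Any.++⁺ʳ ts (proj₂ S.union (c∈S , λ ())) }
  }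
  where
  module R = IsCover covR
  module S = IsCover covS

cover-empty : ∀ {R} → R ⊆ ∅ → HasCover R ∅
cover-empty R⊆∅ = [] , record
  { disjoint  = []
  ; contained = []
  ; union     = (λ ()) , λ (c∈R , _) → ⊥-elim (R⊆∅ c∈R)
  }

cover-tromino : ∀ t → HasCover ⟦ t ⟧ ∅
cover-tromino t = t ∷ [] , record
  { disjoint  = [] ∷ []
  ; contained = (λ c∈t → c∈t , λ ()) ∷ []
  ; union     = (λ { (here c∈t) → c∈t , λ () }) , λ (c∈t , _) → here c∈t
  }

-- Boxes in diagonal coordinates

-- Half-open intervals make boxes with a common bound disjoint and let their lengths add up. The
-- condition s ≡ d (mod 2) is automatic, because a box consists of cells and s + d = 2j.
record Box (x x′ y y′ : ℤ) (c : Cell) : Set where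
  constructor box
  i = proj₁ c
  j = proj₂ c
  field
    x≤s  : x ℤ.≤ i ℤ.+ j
    s<x′ : i ℤ.+ j ℤ.< x′
    y≤d  : y ℤ.≤ j ℤ.- i
    d<y′ : j ℤ.- i ℤ.< y′

box? : ∀ x x′ y y′ → Decidable (Box x x′ y y′)
box? x x′ y y′ (i , j) = map′
  (λ ((x≤s , s<x′) , (y≤d , d<y′)) → box x≤s s<x′ y≤d d<y′)
  (λ (box x≤s s<x′ y≤d d<y′) → (x≤s , s<x′) , (y≤d , d<y′))
  ((x ℤ.≤? i ℤ.+ j ×-dec i ℤ.+ j ℤ.<? x′) ×-dec (y ℤ.≤? j ℤ.- i ×-dec j ℤ.- i ℤ.<? y′))

box-mono : ∀ {x x′ y y′ u u′ w w′} → u ℤ.≤ x → x′ ℤ.≤ u′ → w ℤ.≤ y → y′ ℤ.≤ w′ →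
           Box x x′ y y′ ⊆ Box u u′ w w′
box-mono u≤x x′≤u′ w≤y y′≤w′ (box x≤s s<x′ y≤d d<y′) =
  box (ℤ.≤-trans u≤x x≤s) (ℤ.<-≤-trans s<x′ x′≤u′)
      (ℤ.≤-trans w≤y y≤d) (ℤ.<-≤-trans d<y′ y′≤w′)

box-⊥ˣ : ∀ {x x′ y y′ u u′ w w′} → x′ ℤ.≤ u → Box x x′ y y′ ⊥ Box u u′ w w′
box-⊥ˣ x′≤u (c∈ , c∈′) =
  ℤ.<⇒≱ (Box.s<x′ c∈) (ℤ.≤-trans x′≤u (Box.x≤s c∈′))

box-⊥ʸ : ∀ {x x′ y y′ u u′ w w′} → y′ ℤ.≤ w → Box x x′ y y′ ⊥ Box u u′ w w′
box-⊥ʸ y′≤w (c∈ , c∈′) =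
  ℤ.<⇒≱ (Box.d<y′ c∈) (ℤ.≤-trans y′≤w (Box.y≤d c∈′))

box-translate : ∀ {x x′ y y′} i j {c} → c ∈ Box x x′ y y′ →
  translate (i , j) c ∈
    Box (i ℤ.+ j ℤ.+ x) (i ℤ.+ j ℤ.+ x′) (j ℤ.- i ℤ.+ y) (j ℤ.- i ℤ.+ y′)
box-translate {x} {x′} {y} {y′} i j {p , q} (box x≤s s<x′ y≤d d<y′) =
  box (≤-diff x≤s (loˣ i j p q x)) (<-diff s<x′ (hiˣ i j p q x′))
      (≤-diff y≤d (loʸ i j p q y)) (<-diff d<y′ (hiʸ i j p q y′))
  where
  loˣ : ∀ i j p q x →
    ((i ℤ.+ p) ℤ.+ (j ℤ.+ q)) ℤ.- (i ℤ.+ j ℤ.+ x) ≡ (p ℤ.+ q) ℤ.- x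
  loˣ = ℤ-solve-∀
  hiˣ : ∀ i j p q x →
    (i ℤ.+ j ℤ.+ x) ℤ.- ((i ℤ.+ p) ℤ.+ (j ℤ.+ q)) ≡ x ℤ.- (p ℤ.+ q)
  hiˣ = ℤ-solve-∀
  loʸ : ∀ i j p q y →
    ((j ℤ.+ q) ℤ.- (i ℤ.+ p)) ℤ.- (j ℤ.- i ℤ.+ y) ≡ (q ℤ.- p) ℤ.- y
  loʸ = ℤ-solve-∀
  hiʸ : ∀ i j p q y →
    (j ℤ.- i ℤ.+ y) ℤ.- ((j ℤ.+ q) ℤ.- (i ℤ.+ p)) ≡ y ℤ.- (q ℤ.- p)
  hiʸ = ℤ-solve-∀

cover-joinˣ : ∀ {x m x′ y y′} → x ℤ.≤ m → m ℤ.≤ x′ →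
  HasCover (Box x m y y′) ∅ → HasCover (Box m x′ y y′) ∅ → HasCover (Box x x′ y y′) ∅
cover-joinˣ {x} {m} {x′} {y} {y′} x≤m m≤x′ L R =
  cover-resp-≐ (to , from) (cover-∪ (box-⊥ˣ ℤ.≤-refl) L R)
  where
  to : Box x m y y′ ∪ Box m x′ y y′ ⊆ Box x x′ y y′
  to (inj₁ c∈L) = box-mono ℤ.≤-refl m≤x′ ℤ.≤-refl ℤ.≤-refl c∈L
  to (inj₂ c∈R) = box-mono x≤m ℤ.≤-refl ℤ.≤-refl ℤ.≤-refl c∈R
  from : Box x x′ y y′ ⊆ Box x m y y′ ∪ Box m x′ y y′
  from {i , j} (box x≤s s<x′ y≤d d<y′) with i ℤ.+ j ℤ.<? m
  ... | yes s<m = inj₁ (box x≤s s<m y≤d d<y′)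
  ... | no  s≮m = inj₂ (box (ℤ.≮⇒≥ s≮m) s<x′ y≤d d<y′)

cover-joinʸ : ∀ {x x′ y m y′} → y ℤ.≤ m → m ℤ.≤ y′ →
  HasCover (Box x x′ y m) ∅ → HasCover (Box x x′ m y′) ∅ → HasCover (Box x x′ y y′) ∅
cover-joinʸ {x} {x′} {y} {m} {y′} y≤m m≤y′ L R =
  cover-resp-≐ (to , from) (cover-∪ (box-⊥ʸ ℤ.≤-refl) L R)
  where
  to : Box x x′ y m ∪ Box x x′ m y′ ⊆ Box x x′ y y′
  to (inj₁ c∈L) = box-mono ℤ.≤-refl ℤ.≤-refl ℤ.≤-refl m≤y′ c∈L
  to (inj₂ c∈R) = box-mono ℤ.≤-refl ℤ.≤-refl y≤m ℤ.≤-refl c∈R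
  from : Box x x′ y y′ ⊆ Box x x′ y m ∪ Box x x′ m y′
  from {i , j} (box x≤s s<x′ y≤d d<y′) with j ℤ.- i ℤ.<? m
  ... | yes d<m = inj₁ (box x≤s s<x′ y≤d d<m)
  ... | no  d≮m = inj₂ (box x≤s s<x′ (ℤ.≮⇒≥ d≮m) d<y′)

-- The piece is required at every x: for odd k, consecutive pieces have opposite parity patterns and
-- are not translates of one another.
cover-repeatˣ : ∀ k {y y′} → (∀ x → HasCover (Box x (x ℤ.+ + k) y y′) ∅) →
                ∀ m x → HasCover (Box x (x ℤ.+ + (m * k)) y y′) ∅
cover-repeatˣ k cov zero x = cover-empty λ (box x≤s s<x _ _) →
  ℤ.<⇒≱ (subst (_ ℤ.<_) (ℤ.+-identityʳ x) s<x) x≤s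
cover-repeatˣ k cov (suc m) x =
  subst (λ x′ → HasCover (Box x x′ _ _) ∅) (ℤ.+-assoc x (+ k) (+ (m * k)))
    (cover-joinˣ (ℤ.i≤i+j x (+ k)) (ℤ.i≤i+j (x ℤ.+ + k) (+ (m * k)))
      (cov x) (cover-repeatˣ k cov m (x ℤ.+ + k)))

cover-repeatʸ : ∀ k {x x′} → (∀ y → HasCover (Box x x′ y (y ℤ.+ + k)) ∅) →
                ∀ n y → HasCover (Box x x′ y (y ℤ.+ + (n * k))) ∅
cover-repeatʸ k cov zero y = cover-empty λ (box _ _ y≤d d<y) →
  ℤ.<⇒≱ (subst (_ ℤ.<_) (ℤ.+-identityʳ y) d<y) y≤d
cover-repeatʸ k cov (suc n) y =
  subst (λ y′ → HasCover (Box _ _ y y′) ∅) (ℤ.+-assoc y (+ k) (+ (n * k)))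
    (cover-joinʸ (ℤ.i≤i+j y (+ k)) (ℤ.i≤i+j (y ℤ.+ + k) (+ (n * k)))
      (cov y) (cover-repeatʸ k cov n (y ℤ.+ + k)))

module _ {x₀ x₁ x₂ x₃ y₀ y₁ y₂ y₃}
  (x₀≤x₁ : x₀ ℤ.≤ x₁) (x₁≤x₂ : x₁ ℤ.≤ x₂) (x₂≤x₃ : x₂ ℤ.≤ x₃)
  (y₀≤y₁ : y₀ ℤ.≤ y₁) (y₁≤y₂ : y₁ ℤ.≤ y₂) (y₂≤y₃ : y₂ ℤ.≤ y₃) where

  -- With s drawn to the right and d upwards, the boxes lie at the bottom, right, top and left,
  -- winding around the centre [x₁,x₂) × [y₁,y₂). Any two of them are separated by a bound on s or
  -- on d.
  cover-pinwheel :
    HasCover (Box x₀ x₂ y₀ y₁) ∅ → HasCover (Box x₂ x₃ y₀ y₂) ∅ →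
    HasCover (Box x₁ x₃ y₂ y₃) ∅ → HasCover (Box x₀ x₁ y₁ y₃) ∅ →
    Box x₁ x₂ y₁ y₂ ⊆ ∅ → HasCover (Box x₀ x₃ y₀ y₃) ∅
  cover-pinwheel C₁ C₂ C₃ C₄ centre⊆∅ = cover-resp-≐ (to , from)
    (cover-∪
      (λ { (c∈₁ , inj₁ c∈₂)        → box-⊥ˣ ℤ.≤-refl (c∈₁ , c∈₂)
         ; (c∈₁ , inj₂ (inj₁ c∈₃)) → box-⊥ʸ y₁≤y₂ (c∈₁ , c∈₃)
         ; (c∈₁ , inj₂ (inj₂ c∈₄)) → box-⊥ʸ ℤ.≤-refl (c∈₁ , c∈₄) })
      C₁ (cover-∪
      (λ { (c∈₂ , inj₁ c∈₃) → box-⊥ʸ ℤ.≤-refl (c∈₂ , c∈₃)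
         ; (c∈₂ , inj₂ c∈₄) → box-⊥ˣ x₁≤x₂ (c∈₄ , c∈₂) })
      C₂ (cover-∪ (λ (c∈₃ , c∈₄) → box-⊥ˣ ℤ.≤-refl (c∈₄ , c∈₃)) C₃ C₄)))
    where
    Pieces : CellSet
    Pieces = Box x₀ x₂ y₀ y₁ ∪ (Box x₂ x₃ y₀ y₂ ∪ (Box x₁ x₃ y₂ y₃ ∪ Box x₀ x₁ y₁ y₃))
    x₀≤x₂ = ℤ.≤-trans x₀≤x₁ x₁≤x₂
    x₁≤x₃ = ℤ.≤-trans x₁≤x₂ x₂≤x₃
    y₀≤y₂ = ℤ.≤-trans y₀≤y₁ y₁≤y₂
    y₁≤y₃ = ℤ.≤-trans y₁≤y₂ y₂≤y₃
    to : Pieces ⊆ Box x₀ x₃ y₀ y₃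
    to (inj₁ c∈)               = box-mono ℤ.≤-refl x₂≤x₃ ℤ.≤-refl y₁≤y₃ c∈
    to (inj₂ (inj₁ c∈))        = box-mono x₀≤x₂ ℤ.≤-refl ℤ.≤-refl y₂≤y₃ c∈
    to (inj₂ (inj₂ (inj₁ c∈))) = box-mono x₀≤x₁ ℤ.≤-refl y₀≤y₂ ℤ.≤-refl c∈
    to (inj₂ (inj₂ (inj₂ c∈))) = box-mono ℤ.≤-refl x₁≤x₃ y₀≤y₁ ℤ.≤-refl c∈
    from : Box x₀ x₃ y₀ y₃ ⊆ Pieces
    from {i , j} (box x₀≤s s<x₃ y₀≤d d<y₃)
      with i ℤ.+ j ℤ.<? x₁ | i ℤ.+ j ℤ.<? x₂ | j ℤ.- i ℤ.<? y₁ | j ℤ.- i ℤ.<? y₂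
    ... | _        | yes s<x₂ | yes d<y₁ | _        =
      inj₁ (box x₀≤s s<x₂ y₀≤d d<y₁)
    ... | _        | no  s≮x₂ | _        | yes d<y₂ =
      inj₂ (inj₁ (box (ℤ.≮⇒≥ s≮x₂) s<x₃ y₀≤d d<y₂))
    ... | no  s≮x₁ | _        | _        | no  d≮y₂ =
      inj₂ (inj₂ (inj₁ (box (ℤ.≮⇒≥ s≮x₁) s<x₃ (ℤ.≮⇒≥ d≮y₂) d<y₃)))
    ... | yes s<x₁ | _        | no  d≮y₁ | _        =
      inj₂ (inj₂ (inj₂ (box x₀≤s s<x₁ (ℤ.≮⇒≥ d≮y₁) d<y₃)))
    -- A point that none of the four boxes contains lies in the centre, which has no cells.
    ... | no  s≮x₁ | yes s<x₂ | no  d≮y₁ | yes d<y₂ =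
      ⊥-elim (centre⊆∅ {i , j} (box (ℤ.≮⇒≥ s≮x₁) s<x₂ (ℤ.≮⇒≥ d≮y₁) d<y₂))
    ... | _        | _        | yes d<y₁ | no  d≮y₂ =
      ⊥-elim (d≮y₂ (ℤ.<-≤-trans d<y₁ y₁≤y₂))

-- Trominoes as boxes

-- Half-open ranges of s and d over the three cells. The full block has ranges [0,3) and [-1,2), and
-- each of its cells is the only one attaining one of the four extremes, so removing it shortens one
-- range by 1 at that end.
sLo sHi dLo dHi : Shape → ℤ
sLo without-00 = 1ℤ
sLo _          = 0ℤ
sHi without-11 = + 2
sHi _          = + 3
dLo without-10 = 0ℤ
dLo _          = -1ℤ
dHi without-01 = 1ℤ
dHi _          = + 2

ShapeBox : Shape → CellSet
ShapeBox sh = Box (sLo sh) (sHi sh) (dLo sh) (dHi sh)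

shapeBox? : ∀ sh → Decidable (ShapeBox sh)
shapeBox? sh = box? (sLo sh) (sHi sh) (dLo sh) (dHi sh)

blockCells : List Cell
blockCells = (0ℤ , 0ℤ) ∷ (1ℤ , 0ℤ) ∷ (0ℤ , 1ℤ) ∷ (1ℤ , 1ℤ) ∷ []

-- Since 2p = s - d and 2q = s + d, both doubles lie between -1 and 3, which leaves only 0 and 1 for
-- p and q.
Box⊆blockCells : Box 0ℤ (+ 3) -1ℤ (+ 2) ⊆ (_∈ₗ blockCells)
Box⊆blockCells {p , q} (box 0≤s s<3 -1≤d d<2) = member
  (0≤i≤1⇒i≡0∨i≡1 (half-≤ (≤-diff (ℤ.+-mono-≤ 0≤s d≤1) (loᵖ p q)))
                 (half-≤ (≤-diff (ℤ.+-mono-≤ s≤2 -1≤d) (hiᵖ p q))))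
  (0≤i≤1⇒i≡0∨i≡1 (half-≤ (≤-diff (ℤ.+-mono-≤ 0≤s -1≤d) (lo^q p q)))
                 (half-≤ (≤-diff (ℤ.+-mono-≤ s≤2 d≤1) (hi^q p q))))
  where
  s≤2 : p ℤ.+ q ℤ.≤ + 2
  s≤2 = ℤ.i<j⇒i≤pred[j] s<3
  d≤1 : q ℤ.- p ℤ.≤ 1ℤ
  d≤1 = ℤ.i<j⇒i≤pred[j] d<2
  loᵖ : ∀ p q → 1ℤ ℤ.+ (p ℤ.+ p) ℤ.- 0ℤ ≡ (p ℤ.+ q ℤ.+ 1ℤ) ℤ.- (0ℤ ℤ.+ (q ℤ.- p))
  loᵖ = ℤ-solve-∀
  hiᵖ : ∀ p q → + 3 ℤ.- (p ℤ.+ p) ≡ (+ 2 ℤ.+ (q ℤ.- p)) ℤ.- (p ℤ.+ q ℤ.+ -1ℤ)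
  hiᵖ = ℤ-solve-∀
  lo^q : ∀ p q → 1ℤ ℤ.+ (q ℤ.+ q) ℤ.- 0ℤ ≡ (p ℤ.+ q ℤ.+ (q ℤ.- p)) ℤ.- -1ℤ
  lo^q = ℤ-solve-∀
  hi^q : ∀ p q → + 3 ℤ.- (q ℤ.+ q) ≡ + 3 ℤ.- (p ℤ.+ q ℤ.+ (q ℤ.- p))
  hi^q = ℤ-solve-∀
  member : ∀ {p q} → p ≡ 0ℤ ⊎ p ≡ 1ℤ → q ≡ 0ℤ ⊎ q ≡ 1ℤ → (p , q) ∈ₗ blockCells
  member (inj₁ refl) (inj₁ refl) = here refl
  member (inj₂ refl) (inj₁ refl) = there (here refl)
  member (inj₁ refl) (inj₂ refl) = there (there (here refl))
  member (inj₂ refl) (inj₂ refl) = there (there (there (here refl)))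

shapeBox⊆blockCells : ∀ sh → ShapeBox sh ⊆ (_∈ₗ blockCells)
shapeBox⊆blockCells sh = Box⊆blockCells ∘ box-mono (0≤sLo sh) (sHi≤3 sh) (-1≤dLo sh) (dHi≤2 sh)
  where
  0≤sLo : ∀ sh → 0ℤ ℤ.≤ sLo sh
  0≤sLo without-11 = ℤ.+≤+ z≤n
  0≤sLo without-01 = ℤ.+≤+ z≤n
  0≤sLo without-10 = ℤ.+≤+ z≤n
  0≤sLo without-00 = ℤ.+≤+ z≤n
  sHi≤3 : ∀ sh → sHi sh ℤ.≤ + 3
  sHi≤3 without-11 = ℤ.i≤suc[i] (+ 2)
  sHi≤3 without-01 = ℤ.≤-refl
  sHi≤3 without-10 = ℤ.≤-refl
  sHi≤3 without-00 = ℤ.≤-refl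
  -1≤dLo : ∀ sh → -1ℤ ℤ.≤ dLo sh
  -1≤dLo without-11 = ℤ.≤-refl
  -1≤dLo without-01 = ℤ.≤-refl
  -1≤dLo without-10 = ℤ.-≤+
  -1≤dLo without-00 = ℤ.≤-refl
  dHi≤2 : ∀ sh → dHi sh ℤ.≤ + 2
  dHi≤2 without-11 = ℤ.≤-refl
  dHi≤2 without-01 = ℤ.i≤suc[i] 1ℤ
  dHi≤2 without-10 = ℤ.≤-refl
  dHi≤2 without-00 = ℤ.≤-refl

-- Only the four cells of the block can lie in the box of a shape, so both inclusions are finite
-- checks, settled by evaluating decision procedures.
shapeCells≐ : ∀ sh → (_∈ₗ shapeCells sh) ≐ ShapeBox sh
shapeCells≐ sh = All.lookup (cells⊆box sh) ,
  λ c∈ → All.lookup (box⊆cells sh) (shapeBox⊆blockCells sh c∈) c∈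
  where
  cells⊆box : ∀ sh → All (ShapeBox sh) (shapeCells sh)
  cells⊆box without-11 = from-yes (all? (shapeBox? without-11) (shapeCells without-11))
  cells⊆box without-01 = from-yes (all? (shapeBox? without-01) (shapeCells without-01))
  cells⊆box without-10 = from-yes (all? (shapeBox? without-10) (shapeCells without-10))
  cells⊆box without-00 = from-yes (all? (shapeBox? without-00) (shapeCells without-00))

  included? : ∀ sh → Decidable (λ c → ShapeBox sh c → c ∈ₗ shapeCells sh)
  included? sh c = shapeBox? sh c →-dec Any.any? (≡-dec ℤ._≟_ ℤ._≟_ c) (shapeCells sh)

  box⊆cells : ∀ sh → All (λ c → ShapeBox sh c → c ∈ₗ shapeCells sh) blockCells
  box⊆cells without-11 = from-yes (all? (included? without-11) blockCells)
  box⊆cells without-01 = from-yes (all? (included? without-01) blockCells)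
  box⊆cells without-10 = from-yes (all? (included? without-10) blockCells)
  box⊆cells without-00 = from-yes (all? (included? without-00) blockCells)

tromino≐ : ∀ sh i j → ⟦ tromino sh (i , j) ⟧ ≐
  Box (i ℤ.+ j ℤ.+ sLo sh) (i ℤ.+ j ℤ.+ sHi sh) (j ℤ.- i ℤ.+ dLo sh) (j ℤ.- i ℤ.+ dHi sh)
tromino≐ sh i j = to , from
  where
  to : ⟦ tromino sh (i , j) ⟧ ⊆ _
  to c∈ with ∈-map⁻ (translate (i , j)) c∈
  ... | c₀ , c₀∈ , refl = box-translate i j {c₀} (proj₁ (shapeCells≐ sh) c₀∈)

  cancelˢ : ∀ i j x → ℤ.- i ℤ.+ ℤ.- j ℤ.+ (i ℤ.+ j ℤ.+ x) ≡ x
  cancelˢ = ℤ-solve-∀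
  cancelᵈ : ∀ i j y → ℤ.- j ℤ.- ℤ.- i ℤ.+ (j ℤ.- i ℤ.+ y) ≡ y
  cancelᵈ = ℤ-solve-∀
  cancel : ∀ i p → i ℤ.+ (ℤ.- i ℤ.+ p) ≡ p
  cancel = ℤ-solve-∀

  from : _ ⊆ ⟦ tromino sh (i , j) ⟧
  -- Translating by (-i, -j) brings the cell back into the box of the untranslated shape.
  from {p , q} c∈ = subst (_∈ₗ _) (cong₂ _,_ (cancel i p) (cancel j q))
    (∈-map⁺ (translate (i , j)) (proj₂ (shapeCells≐ sh)
      (subst (translate (ℤ.- i , ℤ.- j) (p , q) ∈_) box≡
        (box-translate (ℤ.- i) (ℤ.- j) {p , q} c∈))))
    where
    box≡ : Box _ _ _ _ ≡ ShapeBox sh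
    box≡ = cong₂ (λ (x , x′) (y , y′) → Box x x′ y y′)
      (cong₂ _,_ (cancelˢ i j (sLo sh)) (cancelˢ i j (sHi sh)))
      (cong₂ _,_ (cancelᵈ i j (dLo sh)) (cancelᵈ i j (dHi sh)))

-- Upper bounds are written as lower bound plus length, so that for a concrete shape the lengths
-- evaluate to 2 and 3.
cover-shape : ∀ sh i j {x y} → i ℤ.+ j ℤ.+ sLo sh ≡ x → j ℤ.- i ℤ.+ dLo sh ≡ y →
  HasCover (Box x (x ℤ.+ (sHi sh ℤ.- sLo sh)) y (y ℤ.+ (dHi sh ℤ.- dLo sh))) ∅
cover-shape sh i j refl refl =
  subst₂ (λ x′ y′ → HasCover (Box (i ℤ.+ j ℤ.+ sLo sh) x′ (j ℤ.- i ℤ.+ dLo sh) y′) ∅)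
    (width (i ℤ.+ j) (sLo sh) (sHi sh)) (width (j ℤ.- i) (dLo sh) (dHi sh))
    (cover-resp-≐ (tromino≐ sh i j) (cover-tromino (tromino sh (i , j))))
  where
  width : ∀ k lo hi → k ℤ.+ hi ≡ k ℤ.+ lo ℤ.+ (hi ℤ.- lo)
  width = ℤ-solve-∀

-- Covers of boxes with one side divisible by 2 and the other by 3

x-y≡k⇒y≡x-k : ∀ x y {k} → x ℤ.- y ≡ k → x ℤ.- k ≡ y
x-y≡k⇒y≡x-k x y refl = eq x y
  where
  eq : ∀ x y → x ℤ.- (x ℤ.- y) ≡ y
  eq = ℤ-solve-∀

-- Three of the six points of the box have s ≡ d, and the parity of x - y decides which. If it is
-- even, two of them have s = x and one has s = x + 1; if it is odd, the reverse. Each pattern is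
-- one orientation of the tromino.
cover-2×3 : ∀ x y → HasCover (Box x (x ℤ.+ + 2) y (y ℤ.+ + 3)) ∅
cover-2×3 x y with parity (x ℤ.- y)
-- The offset has s = x - 1, because the least s in `without-00` is 1.
... | h , inj₁ eq = cover-shape without-00 (h ℤ.- 1ℤ) (x ℤ.- h) (eqˢ x h)
  (trans (eqᵈ x h) (x-y≡k⇒y≡x-k x y eq))
  where
  eqˢ : ∀ x h → h ℤ.- 1ℤ ℤ.+ (x ℤ.- h) ℤ.+ 1ℤ ≡ x
  eqˢ = ℤ-solve-∀
  eqᵈ : ∀ x h → (x ℤ.- h) ℤ.- (h ℤ.- 1ℤ) ℤ.+ -1ℤ ≡ x ℤ.- (h ℤ.+ h)
  eqᵈ = ℤ-solve-∀
... | h , inj₂ eq = cover-shape without-11 h (x ℤ.- h) (eqˢ x h)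
  (trans (eqᵈ x h) (x-y≡k⇒y≡x-k x y eq))
  where
  eqˢ : ∀ x h → h ℤ.+ (x ℤ.- h) ℤ.+ 0ℤ ≡ x
  eqˢ = ℤ-solve-∀
  eqᵈ : ∀ x h → (x ℤ.- h) ℤ.- h ℤ.+ -1ℤ ≡ x ℤ.- (1ℤ ℤ.+ (h ℤ.+ h))
  eqᵈ = ℤ-solve-∀

-- As in the 2 × 3 case, with the roles of s and d exchanged: the parity of x - y tells whether the
-- middle cell of the tromino has the larger or the smaller d.
cover-3×2 : ∀ x y → HasCover (Box x (x ℤ.+ + 3) y (y ℤ.+ + 2)) ∅
cover-3×2 x y with parity (x ℤ.- y)
... | h , inj₁ eq = cover-shape without-10 h (x ℤ.- h) (eqˢ x h)
  (trans (eqᵈ x h) (x-y≡k⇒y≡x-k x y eq))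
  where
  eqˢ : ∀ x h → h ℤ.+ (x ℤ.- h) ℤ.+ 0ℤ ≡ x
  eqˢ = ℤ-solve-∀
  eqᵈ : ∀ x h → (x ℤ.- h) ℤ.- h ℤ.+ 0ℤ ≡ x ℤ.- (h ℤ.+ h)
  eqᵈ = ℤ-solve-∀
... | h , inj₂ eq = cover-shape without-01 h (x ℤ.- h) (eqˢ x h)
  (trans (eqᵈ x h) (x-y≡k⇒y≡x-k x y eq))
  where
  eqˢ : ∀ x h → h ℤ.+ (x ℤ.- h) ℤ.+ 0ℤ ≡ x
  eqˢ = ℤ-solve-∀
  eqᵈ : ∀ x h → (x ℤ.- h) ℤ.- h ℤ.+ -1ℤ ≡ x ℤ.- (1ℤ ℤ.+ (h ℤ.+ h))
  eqᵈ = ℤ-solve-∀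

-- The upper bounds enter through equations, so that sides depending on parameters can be supplied
-- by the ring solver.
cover-2m×3n : ∀ m n {x x′ y y′} → x + m * 2 ≡ x′ → y + n * 3 ≡ y′ →
              HasCover (Box (+ x) (+ x′) (+ y) (+ y′)) ∅
cover-2m×3n m n {x} {y = y} refl refl =
  cover-repeatˣ 2 (λ x → cover-repeatʸ 3 (cover-2×3 x) n (+ y)) m (+ x)

cover-3m×2n : ∀ m n {x x′ y y′} → x + m * 3 ≡ x′ → y + n * 2 ≡ y′ →
              HasCover (Box (+ x) (+ x′) (+ y) (+ y′)) ∅
cover-3m×2n m n {x} {y = y} refl refl =
  cover-repeatˣ 3 (λ x → cover-repeatʸ 2 (cover-3×2 x) n (+ y)) m (+ x)

-- Pinwheel covers of Aztec rectangles

aztec≐Box : ∀ a b → Box 0ℤ (+ suc (2 * b)) 1ℤ (+ suc (2 * a + 1)) ≐ AztecRectangle a b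
aztec≐Box a b =
  (λ (box 0≤s s<x′ 1≤d d<y′) → (0≤s , ℤ.i<j⇒i≤pred[j] s<x′) , (1≤d , ℤ.i<j⇒i≤pred[j] d<y′)) ,
  (λ ((0≤s , s≤2b) , (1≤d , d≤2a+1)) → box 0≤s (<-suc s≤2b) 1≤d (<-suc d≤2a+1))
  where
  <-suc : ∀ {i n} → i ℤ.≤ + n → i ℤ.< + suc n
  <-suc i≤n = ℤ.≤-<-trans i≤n (ℤ.+<+ (ℕ.n<1+n _))

x+y≡z⇒x≤z : ∀ x y {z} → x + y ≡ z → + x ℤ.≤ + z
x+y≡z⇒x≤z x y refl = ℤ.+≤+ (ℕ.m≤m+n x y)

-- The only point is s = x, d = x + 1, but s + d = 2j is even for a cell.
unit-box-empty : ∀ x → Box (+ x) (+ suc x) (+ suc x) (+ suc (suc x)) ⊆ ∅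
unit-box-empty x {i , j} (box x≤s s<1+x 1+x≤d d<2+x) = odd≢even (+ x) j
  (sym (trans (sum i j) (trans (cong₂ ℤ._+_
    (ℤ.≤-antisym (ℤ.i<j⇒i≤pred[j] s<1+x) x≤s)
    (ℤ.≤-antisym (ℤ.i<j⇒i≤pred[j] d<2+x) 1+x≤d))
    (cong +_ (ℕ.+-suc x x)))))
  where
  sum : ∀ i j → j ℤ.+ j ≡ (i ℤ.+ j) ℤ.+ (j ℤ.- i)
  sum = ℤ-solve-∀

aztec-cover-2 : ∀ k l → HasCover (AztecRectangle (2 + k * 3) (2 + l * 3)) ∅
aztec-cover-2 k l = cover-resp-≐ (aztec≐Box (2 + k * 3) (2 + l * 3))
  -- The centre is the point (2,3). The total size is (5 + 6l) × (5 + 6k), and the pieces are 3 × 2,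
  -- (2 + 6l) × 3, (3 + 6l) × (2 + 6k) and 2 × (3 + 6k).
  (cover-pinwheel {x₁ = + 2} {x₂ = + 3} {y₁ = + 3} {y₂ = + 4}
    (ℤ.+≤+ z≤n) (ℤ.i≤suc[i] (+ 2)) (x+y≡z⇒x≤z 3 _ (eq₂ l))
    (ℤ.+≤+ (s≤s z≤n)) (ℤ.i≤suc[i] (+ 3)) (x+y≡z⇒x≤z 4 _ (eq₃ʸ k))
    (cover-3m×2n 1 1 refl refl)
    (cover-2m×3n (suc (l * 3)) 1 (eq₂ l) refl)
    (cover-3m×2n (suc (l * 2)) (suc (k * 3)) (eq₃ˣ l) (eq₃ʸ k))
    (cover-2m×3n 1 (suc (k * 2)) refl (eq₄ k))
    (unit-box-empty 2))
  where
  eq₂ : ∀ l → 3 + suc (l * 3) * 2 ≡ suc (2 * (2 + l * 3))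
  eq₂ = ℕ-solve-∀
  eq₃ˣ : ∀ l → 2 + suc (l * 2) * 3 ≡ suc (2 * (2 + l * 3))
  eq₃ˣ = ℕ-solve-∀
  eq₃ʸ : ∀ k → 4 + suc (k * 3) * 2 ≡ suc (2 * (2 + k * 3) + 1)
  eq₃ʸ = ℕ-solve-∀
  eq₄ : ∀ k → 3 + suc (k * 2) * 3 ≡ suc (2 * (2 + k * 3) + 1)
  eq₄ = ℕ-solve-∀

aztec-cover-3 : ∀ k l → HasCover (AztecRectangle (3 + k * 3) (3 + l * 3)) ∅
aztec-cover-3 k l = cover-resp-≐ (aztec≐Box (3 + k * 3) (3 + l * 3))
  -- The centre is the point (3,4). The total size is (7 + 6l) × (7 + 6k), and the pieces are 4 × 3,
  -- (3 + 6l) × 4, (4 + 6l) × (3 + 6k) and 3 × (4 + 6k).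
  (cover-pinwheel {x₁ = + 3} {x₂ = + 4} {y₁ = + 4} {y₂ = + 5}
    (ℤ.+≤+ z≤n) (ℤ.i≤suc[i] (+ 3)) (x+y≡z⇒x≤z 4 _ (eq₂ l))
    (ℤ.+≤+ (s≤s z≤n)) (ℤ.i≤suc[i] (+ 4)) (x+y≡z⇒x≤z 5 _ (eq₃ʸ k))
    (cover-2m×3n 2 1 refl refl)
    (cover-3m×2n (suc (l * 2)) 2 (eq₂ l) refl)
    (cover-2m×3n (2 + l * 3) (suc (k * 2)) (eq₃ˣ l) (eq₃ʸ k))
    (cover-3m×2n 1 (2 + k * 3) refl (eq₄ k))
    (unit-box-empty 3))
  where
  eq₂ : ∀ l → 4 + suc (l * 2) * 3 ≡ suc (2 * (3 + l * 3))
  eq₂ = ℕ-solve-∀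
  eq₃ˣ : ∀ l → 3 + (2 + l * 3) * 2 ≡ suc (2 * (3 + l * 3))
  eq₃ˣ = ℕ-solve-∀
  eq₃ʸ : ∀ k → 5 + suc (k * 2) * 3 ≡ suc (2 * (3 + k * 3) + 1)
  eq₃ʸ = ℕ-solve-∀
  eq₄ : ∀ k → 4 + (2 + k * 3) * 2 ≡ suc (2 * (3 + k * 3) + 1)
  eq₄ = ℕ-solve-∀

-- Counting cells

length-cartesianProductWith : ∀ {A B C : Set} (f : A → B → C) xs ys →
  length (cartesianProductWith f xs ys) ≡ length xs * length ys
length-cartesianProductWith f []       ys = refl
length-cartesianProductWith f (x ∷ xs) ys =
  trans (length-++ (map (f x) ys))
    (cong₂ _+_ (length-map (f x) ys) (length-cartesianProductWith f xs ys))

-- Without repetitions, equality as sets becomes equality as multisets, so the lists are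
-- permutations of each other.
unique∧≐⇒length≡ : ∀ {A : Set} {xs ys : List A} → Unique xs → Unique ys →
                   (_∈ₗ xs) ≐ (_∈ₗ ys) → length xs ≡ length ys
unique∧≐⇒length≡ uxs uys (xs⊆ys , ys⊆xs) =
  ↭-length (∼bag⇒↭ (unique∧set⇒bag uxs uys (mk⇔ xs⊆ys ys⊆xs)))

translate-injective : ∀ v {c c′} → translate v c ≡ translate v c′ → c ≡ c′
translate-injective (i , j) eq =
  cong₂ _,_ (∙-cancelˡ i _ _ (cong proj₁ eq)) (∙-cancelˡ j _ _ (cong proj₂ eq))
  where open import Algebra.Properties.Group (AbelianGroup.group ℤ.+-0-abelianGroup) using (∙-cancelˡ)

cellsOf : LTromino → List Cell
cellsOf (tromino sh v) = map (translate v) (shapeCells sh)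

length-cellsOf : ∀ t → length (cellsOf t) ≡ 3
length-cellsOf (tromino without-11 v) = refl
length-cellsOf (tromino without-01 v) = refl
length-cellsOf (tromino without-10 v) = refl
length-cellsOf (tromino without-00 v) = refl

cellsOf-unique : ∀ t → Unique (cellsOf t)
cellsOf-unique (tromino sh v) = Unique.map⁺ (translate-injective v) (shapeCells-unique sh)
  where
  shapeCells-unique : ∀ sh → Unique (shapeCells sh)
  shapeCells-unique without-11 = ((λ ()) ∷ (λ ()) ∷ []) ∷ ((λ ()) ∷ []) ∷ [] ∷ []
  shapeCells-unique without-01 = ((λ ()) ∷ (λ ()) ∷ []) ∷ ((λ ()) ∷ []) ∷ [] ∷ []
  shapeCells-unique without-10 = ((λ ()) ∷ (λ ()) ∷ []) ∷ ((λ ()) ∷ []) ∷ [] ∷ []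
  shapeCells-unique without-00 = ((λ ()) ∷ (λ ()) ∷ []) ∷ ((λ ()) ∷ []) ∷ [] ∷ []

length-concatMap-cellsOf : ∀ ts → length (concatMap cellsOf ts) ≡ length ts * 3
length-concatMap-cellsOf []       = refl
length-concatMap-cellsOf (t ∷ ts) =
  trans (length-++ (cellsOf t))
    (cong₂ _+_ (length-cellsOf t) (length-concatMap-cellsOf ts))

-- Concatenating the cells of all trominoes lists the region again. Disjointness of the trominoes
-- excludes repetitions, so the two lists have equal length, and each tromino contributes 3.
cover⇒3∣length : ∀ {R cs} → Unique cs → (_∈ₗ cs) ≐ R → HasCover R ∅ →
                 ∃ λ n → length cs ≡ n * 3
cover⇒3∣length ucs (cs⊆R , R⊆cs) (ts , cov) = length ts , trans
  (unique∧≐⇒length≡ ucs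
    (Unique.concat⁺ (All.map⁺ (All.universal cellsOf-unique ts))
      (AllPairs.map⁺ (AllPairs.map (λ t⊥u {c} → t⊥u {c}) disjoint)))
    ( (λ c∈cs → ∈-concatMap⁺ cellsOf (proj₂ union (cs⊆R c∈cs , λ ())))
    , (λ c∈ts → R⊆cs (proj₁ (proj₁ union (∈-concatMap⁻ cellsOf c∈ts))))))
  (length-concatMap-cellsOf ts)
  where open IsCover cov

-- Listing the cells of the Aztec rectangle

diagonal : Cell → Cell
diagonal (u , v) = (u ℤ.- v , u ℤ.+ v)

-- The image of (u, v) has s = 2u and d = 2v, from which u and v are recovered by halving.
diagonal-injective : ∀ {c c′} → diagonal c ≡ diagonal c′ → c ≡ c′
diagonal-injective {u , v} {u′ , v′} eq = cong₂ _,_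
  (double-injective (trans (2u u v) (trans (cong₂ ℤ._+_ eqᵈ eqˢ) (sym (2u u′ v′)))))
  (double-injective (trans (2v u v) (trans (cong₂ ℤ._-_ eqˢ eqᵈ) (sym (2v u′ v′)))))
  where
  eqᵈ : u ℤ.- v ≡ u′ ℤ.- v′
  eqᵈ = cong proj₁ eq
  eqˢ : u ℤ.+ v ≡ u′ ℤ.+ v′
  eqˢ = cong proj₂ eq
  2u : ∀ u v → u ℤ.+ u ≡ (u ℤ.- v) ℤ.+ (u ℤ.+ v)
  2u = ℤ-solve-∀
  2v : ∀ u v → v ℤ.+ v ≡ (u ℤ.+ v) ℤ.- (u ℤ.- v)
  2v = ℤ-solve-∀

gridCell : Cell → ℕ → ℕ → Cell
gridCell o u v = translate o (diagonal (+ u , + v))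

grid : Cell → ℕ → ℕ → List Cell
grid o m n = cartesianProductWith (gridCell o) (upTo m) (upTo n)

grid-unique : ∀ o m n → Unique (grid o m n)
grid-unique o m n = Unique.cartesianProductWith⁺ (gridCell o) injective
  (Unique.upTo⁺ m) (Unique.upTo⁺ n)
  where
  injective : ∀ {u u′ v v′} → gridCell o u v ≡ gridCell o u′ v′ → u ≡ u′ × v ≡ v′
  injective {u} {u′} {v} {v′} eq = ℤ.+-injective (cong proj₁ uv≡) , ℤ.+-injective (cong proj₂ uv≡)
    where
    uv≡ : (+ u , + v) ≡ (+ u′ , + v′)
    uv≡ = diagonal-injective
      (translate-injective o {diagonal (+ u , + v)} {diagonal (+ u′ , + v′)} eq)

length-grid : ∀ o m n → length (grid o m n) ≡ m * n
length-grid o m n = trans (length-cartesianProductWith (gridCell o) (upTo m) (upTo n))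
  (cong₂ _*_ (length-upTo m) (length-upTo n))

Within : (m n : ℤ) → CellSet
Within m n (u , v) = (0ℤ ℤ.≤ u × u ℤ.< m) × (0ℤ ℤ.≤ v × v ℤ.< n)

∈-grid⁺ : ∀ o {m n u v} → Within (+ m) (+ n) (u , v) →
          translate o (diagonal (u , v)) ∈ₗ grid o m n
∈-grid⁺ o ((ℤ.+≤+ _ , ℤ.+<+ u<m) , (ℤ.+≤+ _ , ℤ.+<+ v<n)) =
  ∈-cartesianProductWith⁺ (gridCell o) (∈-upTo⁺ u<m) (∈-upTo⁺ v<n)

∈-grid⁻ : ∀ o m n {c} → c ∈ₗ grid o m n →
          ∃ λ uv → Within (+ m) (+ n) uv × c ≡ translate o (diagonal uv)
∈-grid⁻ o m n c∈ with ∈-cartesianProductWith⁻ (gridCell o) (upTo m) (upTo n) c∈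
... | u , v , u∈ , v∈ , eq = (+ u , + v) ,
  ((ℤ.+≤+ z≤n , ℤ.+<+ (∈-upTo⁻ u∈)) , (ℤ.+≤+ z≤n , ℤ.+<+ (∈-upTo⁻ v∈))) , eq

-- The cells with s even have s = 2u and d = 2v + 2, those with s odd have s = 2u + 1
-- and d = 2v + 1.
evenOrigin oddOrigin : Cell
evenOrigin = (-1ℤ , 1ℤ)
oddOrigin  = (0ℤ , 1ℤ)

even⊎odd : ∀ c → ∃ λ uv →
  c ≡ translate evenOrigin (diagonal uv) ⊎ c ≡ translate oddOrigin (diagonal uv)
even⊎odd (i , j) with parity (i ℤ.+ j)
-- The first coordinate is half of s, and the second is forced by j = 1 + (u + v).
... | h , inj₁ eq = (h , j ℤ.- 1ℤ ℤ.- h) ,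
  inj₁ (cong₂ _,_ (trans (sub i j) (trans (cong (ℤ._- j) eq) (eqⁱ h j))) (eqʲ h j))
  where
  sub : ∀ i j → i ≡ i ℤ.+ j ℤ.- j
  sub = ℤ-solve-∀
  eqⁱ : ∀ h j → h ℤ.+ h ℤ.- j ≡ -1ℤ ℤ.+ (h ℤ.- (j ℤ.- 1ℤ ℤ.- h))
  eqⁱ = ℤ-solve-∀
  eqʲ : ∀ h j → j ≡ 1ℤ ℤ.+ (h ℤ.+ (j ℤ.- 1ℤ ℤ.- h))
  eqʲ = ℤ-solve-∀
... | h , inj₂ eq = (h , j ℤ.- 1ℤ ℤ.- h) ,
  inj₂ (cong₂ _,_ (trans (sub i j) (trans (cong (ℤ._- j) eq) (eqⁱ h j))) (eqʲ h j))
  where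
  sub : ∀ i j → i ≡ i ℤ.+ j ℤ.- j
  sub = ℤ-solve-∀
  eqⁱ : ∀ h j → 1ℤ ℤ.+ (h ℤ.+ h) ℤ.- j ≡ 0ℤ ℤ.+ (h ℤ.- (j ℤ.- 1ℤ ℤ.- h))
  eqⁱ = ℤ-solve-∀
  eqʲ : ∀ h j → j ≡ 1ℤ ℤ.+ (h ℤ.+ (j ℤ.- 1ℤ ℤ.- h))
  eqʲ = ℤ-solve-∀

even≢odd : ∀ uv uv′ →
  ¬ translate evenOrigin (diagonal uv) ≡ translate oddOrigin (diagonal uv′)
even≢odd (u , v) (u′ , v′) eq = odd≢even u′ u
  (sym (trans (eqᵉ u v) (trans (cong₂ ℤ._+_ (cong proj₁ eq) (cong proj₂ eq)) (eqᵒ u′ v′))))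
  where
  eqᵉ : ∀ u v → u ℤ.+ u ≡ (-1ℤ ℤ.+ (u ℤ.- v)) ℤ.+ (1ℤ ℤ.+ (u ℤ.+ v))
  eqᵉ = ℤ-solve-∀
  eqᵒ : ∀ u v → (0ℤ ℤ.+ (u ℤ.- v)) ℤ.+ (1ℤ ℤ.+ (u ℤ.+ v)) ≡ 1ℤ ℤ.+ (u ℤ.+ u)
  eqᵒ = ℤ-solve-∀

-- The Aztec rectangle with integer parameters and doubles written as sums, a form to which the
-- integer ring solver and `half-≤` apply directly.
Doubled : (a b : ℤ) → CellSet
Doubled a b (i , j) =
  (0ℤ ℤ.≤ i ℤ.+ j × i ℤ.+ j ℤ.≤ b ℤ.+ b) × (1ℤ ℤ.≤ j ℤ.- i × j ℤ.- i ℤ.≤ 1ℤ ℤ.+ (a ℤ.+ a))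

doubled≡aztec : ∀ a b c → Doubled (+ a) (+ b) c ≡ AztecRectangle a b c
doubled≡aztec a b (i , j) =
  cong₂ (λ x y → (0ℤ ℤ.≤ i ℤ.+ j × i ℤ.+ j ℤ.≤ + x) × (1ℤ ℤ.≤ j ℤ.- i × j ℤ.- i ℤ.≤ + y))
    (2b b) (2a+1 a)
  where
  2b : ∀ b → b + b ≡ 2 * b
  2b = ℕ-solve-∀
  2a+1 : ∀ a → suc (a + a) ≡ 2 * a + 1
  2a+1 = ℕ-solve-∀

≤-diff-suc : ∀ {a b c d} → a ℤ.≤ b → d ℤ.- c ≡ 1ℤ ℤ.+ (b ℤ.- a) → c ℤ.≤ d
≤-diff-suc {a} {b} a≤b eq = ≤-diff (ℤ.i≤j⇒i≤k+j 1ℤ a≤b) (trans eq (assoc a b))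
  where
  assoc : ∀ a b → 1ℤ ℤ.+ (b ℤ.- a) ≡ 1ℤ ℤ.+ b ℤ.- a
  assoc = ℤ-solve-∀

double-≤ : ∀ {a b} → a ℤ.≤ b → a ℤ.+ a ℤ.≤ b ℤ.+ b
double-≤ a≤b = ℤ.+-mono-≤ a≤b a≤b

-- Here s = 2u and d = 2v + 2. Thus 0 ≤ s ≤ 2b means 0 ≤ u ≤ b, while the odd bounds 1 ≤ d ≤ 2a + 1
-- are never attained and give 0 ≤ v < a.
even-doubled : ∀ a b uv → Within (ℤ.suc b) a uv ⇔ Doubled a b (translate evenOrigin (diagonal uv))
even-doubled a b (u , v) = mk⇔
  (λ ((0≤u , u<1+b) , (0≤v , v<a)) →
    ( ≤-diff (double-≤ 0≤u) (s₀ u v)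
    , ≤-diff (double-≤ (ℤ.i<j⇒suc[i]≤j u<1+b)) (s₁ u v b)) ,
    ( ≤-diff-suc (double-≤ 0≤v) (d₀ u v)
    , ≤-diff-suc (double-≤ (ℤ.i<j⇒suc[i]≤j v<a)) (d₁ u v a)))
  (λ ((0≤s , s≤2b) , (1≤d , d≤2a+1)) →
    ( half-≤ (≤-diff-suc 0≤s (u₀ u v))
    , ℤ.suc[i]≤j⇒i<j (ℤ.+-monoʳ-≤ 1ℤ (half-≤ {u} {b} (≤-diff-suc s≤2b (u₁ u v b))))) ,
    ( half-≤ (≤-diff 1≤d (v₀ u v))
    , ℤ.suc[i]≤j⇒i<j (half-≤ (≤-diff d≤2a+1 (v₁ u v a)))))
  where
  s₀ : ∀ u v → (-1ℤ ℤ.+ (u ℤ.- v)) ℤ.+ (1ℤ ℤ.+ (u ℤ.+ v)) ℤ.- 0ℤ ≡ (u ℤ.+ u) ℤ.- 0ℤ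
  s₀ = ℤ-solve-∀
  s₁ : ∀ u v b → (b ℤ.+ b) ℤ.- ((-1ℤ ℤ.+ (u ℤ.- v)) ℤ.+ (1ℤ ℤ.+ (u ℤ.+ v))) ≡
       ((1ℤ ℤ.+ b) ℤ.+ (1ℤ ℤ.+ b)) ℤ.- ((1ℤ ℤ.+ u) ℤ.+ (1ℤ ℤ.+ u))
  s₁ = ℤ-solve-∀
  d₀ : ∀ u v → (1ℤ ℤ.+ (u ℤ.+ v)) ℤ.- (-1ℤ ℤ.+ (u ℤ.- v)) ℤ.- 1ℤ ≡
       1ℤ ℤ.+ ((v ℤ.+ v) ℤ.- 0ℤ)
  d₀ = ℤ-solve-∀
  d₁ : ∀ u v a → (1ℤ ℤ.+ (a ℤ.+ a)) ℤ.- ((1ℤ ℤ.+ (u ℤ.+ v)) ℤ.- (-1ℤ ℤ.+ (u ℤ.- v))) ≡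
       1ℤ ℤ.+ ((a ℤ.+ a) ℤ.- ((1ℤ ℤ.+ v) ℤ.+ (1ℤ ℤ.+ v)))
  d₁ = ℤ-solve-∀
  u₀ : ∀ u v → 1ℤ ℤ.+ (u ℤ.+ u) ℤ.- 0ℤ ≡
       1ℤ ℤ.+ ((-1ℤ ℤ.+ (u ℤ.- v)) ℤ.+ (1ℤ ℤ.+ (u ℤ.+ v)) ℤ.- 0ℤ)
  u₀ = ℤ-solve-∀
  u₁ : ∀ u v b → 1ℤ ℤ.+ (b ℤ.+ b) ℤ.- (u ℤ.+ u) ≡
       1ℤ ℤ.+ ((b ℤ.+ b) ℤ.- ((-1ℤ ℤ.+ (u ℤ.- v)) ℤ.+ (1ℤ ℤ.+ (u ℤ.+ v))))
  u₁ = ℤ-solve-∀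
  v₀ : ∀ u v → 1ℤ ℤ.+ (v ℤ.+ v) ℤ.- 0ℤ ≡
       (1ℤ ℤ.+ (u ℤ.+ v)) ℤ.- (-1ℤ ℤ.+ (u ℤ.- v)) ℤ.- 1ℤ
  v₀ = ℤ-solve-∀
  v₁ : ∀ u v a → 1ℤ ℤ.+ (a ℤ.+ a) ℤ.- ((1ℤ ℤ.+ v) ℤ.+ (1ℤ ℤ.+ v)) ≡
       (1ℤ ℤ.+ (a ℤ.+ a)) ℤ.- ((1ℤ ℤ.+ (u ℤ.+ v)) ℤ.- (-1ℤ ℤ.+ (u ℤ.- v)))
  v₁ = ℤ-solve-∀

-- Here s = 2u + 1 and d = 2v + 1, so now the bounds on s are never attained and those on d can be.
odd-doubled : ∀ a b uv → Within b (ℤ.suc a) uv ⇔ Doubled a b (translate oddOrigin (diagonal uv))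
odd-doubled a b (u , v) = mk⇔
  (λ ((0≤u , u<b) , (0≤v , v<1+a)) →
    ( ≤-diff-suc (double-≤ 0≤u) (s₀ u v)
    , ≤-diff-suc (double-≤ (ℤ.i<j⇒suc[i]≤j u<b)) (s₁ u v b)) ,
    ( ≤-diff (double-≤ 0≤v) (d₀ u v)
    , ≤-diff (double-≤ (ℤ.i<j⇒suc[i]≤j v<1+a)) (d₁ u v a)))
  (λ ((0≤s , s≤2b) , (1≤d , d≤2a+1)) →
    ( half-≤ (≤-diff 0≤s (u₀ u v))
    , ℤ.suc[i]≤j⇒i<j (half-≤ (≤-diff s≤2b (u₁ u v b)))) ,
    ( half-≤ (≤-diff-suc 1≤d (v₀ u v))
    , ℤ.suc[i]≤j⇒i<j (ℤ.+-monoʳ-≤ 1ℤ (half-≤ {v} {a} (≤-diff-suc d≤2a+1 (v₁ u v a))))))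
  where
  s₀ : ∀ u v → (0ℤ ℤ.+ (u ℤ.- v)) ℤ.+ (1ℤ ℤ.+ (u ℤ.+ v)) ℤ.- 0ℤ ≡
       1ℤ ℤ.+ ((u ℤ.+ u) ℤ.- 0ℤ)
  s₀ = ℤ-solve-∀
  s₁ : ∀ u v b → (b ℤ.+ b) ℤ.- ((0ℤ ℤ.+ (u ℤ.- v)) ℤ.+ (1ℤ ℤ.+ (u ℤ.+ v))) ≡
       1ℤ ℤ.+ ((b ℤ.+ b) ℤ.- ((1ℤ ℤ.+ u) ℤ.+ (1ℤ ℤ.+ u)))
  s₁ = ℤ-solve-∀
  d₀ : ∀ u v → (1ℤ ℤ.+ (u ℤ.+ v)) ℤ.- (0ℤ ℤ.+ (u ℤ.- v)) ℤ.- 1ℤ ≡ (v ℤ.+ v) ℤ.- 0ℤ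
  d₀ = ℤ-solve-∀
  d₁ : ∀ u v a → (1ℤ ℤ.+ (a ℤ.+ a)) ℤ.- ((1ℤ ℤ.+ (u ℤ.+ v)) ℤ.- (0ℤ ℤ.+ (u ℤ.- v))) ≡
       ((1ℤ ℤ.+ a) ℤ.+ (1ℤ ℤ.+ a)) ℤ.- ((1ℤ ℤ.+ v) ℤ.+ (1ℤ ℤ.+ v))
  d₁ = ℤ-solve-∀
  u₀ : ∀ u v → 1ℤ ℤ.+ (u ℤ.+ u) ℤ.- 0ℤ ≡
       (0ℤ ℤ.+ (u ℤ.- v)) ℤ.+ (1ℤ ℤ.+ (u ℤ.+ v)) ℤ.- 0ℤ
  u₀ = ℤ-solve-∀
  u₁ : ∀ u v b → 1ℤ ℤ.+ (b ℤ.+ b) ℤ.- ((1ℤ ℤ.+ u) ℤ.+ (1ℤ ℤ.+ u)) ≡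
       (b ℤ.+ b) ℤ.- ((0ℤ ℤ.+ (u ℤ.- v)) ℤ.+ (1ℤ ℤ.+ (u ℤ.+ v)))
  u₁ = ℤ-solve-∀
  v₀ : ∀ u v → 1ℤ ℤ.+ (v ℤ.+ v) ℤ.- 0ℤ ≡
       1ℤ ℤ.+ ((1ℤ ℤ.+ (u ℤ.+ v)) ℤ.- (0ℤ ℤ.+ (u ℤ.- v)) ℤ.- 1ℤ)
  v₀ = ℤ-solve-∀
  v₁ : ∀ u v a → 1ℤ ℤ.+ (a ℤ.+ a) ℤ.- (v ℤ.+ v) ≡
       1ℤ ℤ.+ ((1ℤ ℤ.+ (a ℤ.+ a)) ℤ.- ((1ℤ ℤ.+ (u ℤ.+ v)) ℤ.- (0ℤ ℤ.+ (u ℤ.- v))))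
  v₁ = ℤ-solve-∀

-- Two interleaved rectangular grids, for s even and s odd; they account for the two terms of the
-- cell count.
aztecCells : (a b : ℕ) → List Cell
aztecCells a b = grid evenOrigin (suc b) a ++ grid oddOrigin b (suc a)

aztecCells-unique : ∀ a b → Unique (aztecCells a b)
aztecCells-unique a b =
  Unique.++⁺ (grid-unique evenOrigin (suc b) a) (grid-unique oddOrigin b (suc a))
  λ (c∈even , c∈odd) →
    let uv  , _ , eq  = ∈-grid⁻ evenOrigin (suc b) a c∈even
        uv′ , _ , eq′ = ∈-grid⁻ oddOrigin b (suc a) c∈odd
    in even≢odd uv uv′ (trans (sym eq) eq′)

size : ℕ → ℕ → ℕ
size a b = a * (b + 1) + b * (a + 1)

length-aztecCells : ∀ a b → length (aztecCells a b) ≡ size a b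
length-aztecCells a b = trans (length-++ (grid evenOrigin (suc b) a))
  (trans (cong₂ _+_ (length-grid evenOrigin (suc b) a) (length-grid oddOrigin b (suc a))) (eq a b))
  where
  eq : ∀ a b → suc b * a + b * suc a ≡ a * (b + 1) + b * (a + 1)
  eq = ℕ-solve-∀

aztecCells≐ : ∀ a b → (_∈ₗ aztecCells a b) ≐ AztecRectangle a b
aztecCells≐ a b = to , from
  where
  to : (_∈ₗ aztecCells a b) ⊆ AztecRectangle a b
  to {c} c∈ with ∈-++⁻ (grid evenOrigin (suc b) a) c∈
  ... | inj₁ c∈even with ∈-grid⁻ evenOrigin (suc b) a c∈even
  ...   | uv , uv∈ , refl =
          subst (λ P → P) (doubled≡aztec a b c) (Equivalence.to (even-doubled (+ a) (+ b) uv) uv∈)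
  to {c} c∈ | inj₂ c∈odd with ∈-grid⁻ oddOrigin b (suc a) c∈odd
  ...   | uv , uv∈ , refl =
          subst (λ P → P) (doubled≡aztec a b c) (Equivalence.to (odd-doubled (+ a) (+ b) uv) uv∈)

  from : AztecRectangle a b ⊆ (_∈ₗ aztecCells a b)
  from {c} c∈ with even⊎odd c | subst (λ P → P) (sym (doubled≡aztec a b c)) c∈
  ... | uv , inj₁ refl | c∈′ =
    ∈-++⁺ˡ (∈-grid⁺ evenOrigin (Equivalence.from (even-doubled (+ a) (+ b) uv) c∈′))
  ... | uv , inj₂ refl | c∈′ =
    ∈-++⁺ʳ _ (∈-grid⁺ oddOrigin (Equivalence.from (odd-doubled (+ a) (+ b) uv) c∈′))

-- Residues modulo 3 and the equivalence

size%3 : ∀ r q r′ q′ → size (r + q * 3) (r′ + q′ * 3) % 3 ≡ size r r′ % 3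
size%3 r q r′ q′ = trans (cong (_% 3) (eq r q r′ q′)) ([m+kn]%n≡m%n (size r r′) (k r q r′ q′) 3)
  where
  k : (r q r′ q′ : ℕ) → ℕ
  -- The size is 2ab + a + b. Expanding it at a = r + 3q and b = r′ + 3q′ leaves this multiple of 3
  -- beyond the size at (r, r′).
  k r q r′ q′ = q + q′ + 2 * (r * q′ + q * r′ + 3 * (q * q′))
  eq : ∀ r q r′ q′ →
    (r + q * 3) * (r′ + q′ * 3 + 1) + (r′ + q′ * 3) * (r + q * 3 + 1) ≡
    (r * (r′ + 1) + r′ * (r + 1)) + (q + q′ + 2 * (r * q′ + q * r′ + 3 * (q * q′))) * 3
  eq = ℕ-solve-∀

3∣size⇒cover : ∀ a b → .{{_ : NonZero a}} → .{{_ : NonZero b}} →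
               size a b % 3 ≡ 0 → HasCover (AztecRectangle a b) ∅
3∣size⇒cover a b = by-divMod (a divMod 3) (b divMod 3)
  where
  by-residues : ∀ (r r′ : Fin 3) q q′ →
    .{{_ : NonZero (toℕ r + q * 3)}} → .{{_ : NonZero (toℕ r′ + q′ * 3)}} →
    size (toℕ r) (toℕ r′) % 3 ≡ 0 →
    HasCover (AztecRectangle (toℕ r + q * 3) (toℕ r′ + q′ * 3)) ∅
  -- A positive multiple of 3 has a nonzero quotient, hence the form 3 + 3k.
  by-residues zero zero (suc k) (suc l) _ = aztec-cover-3 k l
  by-residues zero zero zero _ {{a≢0}} _ = ⊥-elim (≢-nonZero⁻¹ 0 {{a≢0}} refl)
  by-residues zero zero (suc _) zero {{_}} {{b≢0}} _ = ⊥-elim (≢-nonZero⁻¹ 0 {{b≢0}} refl)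
  by-residues (suc (suc zero)) (suc (suc zero)) k l _ = aztec-cover-2 k l
  -- For the remaining residues 2rr′ + r + r′ evaluates to 1 or 2 modulo 3, which refutes the
  -- hypothesis.
  by-residues zero (suc zero) _ _ ()
  by-residues zero (suc (suc zero)) _ _ ()
  by-residues (suc zero) zero _ _ ()
  by-residues (suc zero) (suc zero) _ _ ()
  by-residues (suc zero) (suc (suc zero)) _ _ ()
  by-residues (suc (suc zero)) zero _ _ ()
  by-residues (suc (suc zero)) (suc zero) _ _ ()

  by-divMod : ∀ {a b} → .{{_ : NonZero a}} → .{{_ : NonZero b}} → DivMod a 3 → DivMod b 3 →
              size a b % 3 ≡ 0 → HasCover (AztecRectangle a b) ∅
  by-divMod (result q r refl) (result q′ r′ refl) 3∣size =
    by-residues r r′ q q′ (trans (sym (size%3 (toℕ r) q (toℕ r′) q′)) 3∣size)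

theorem1 : ∀ (a b : ℕ) → .{{_ : NonZero a}} → .{{_ : NonZero b}} →
    HasCover (AztecRectangle a b) ∅ ⇔ ((a * (b + 1) + b * (a + 1)) % 3 ≡ 0)
theorem1 a b = mk⇔ to (3∣size⇒cover a b)
  where
  to : HasCover (AztecRectangle a b) ∅ → size a b % 3 ≡ 0
  to cov =
    let n , length≡n*3 = cover⇒3∣length (aztecCells-unique a b) (aztecCells≐ a b) cov
    in trans (cong (_% 3) (trans (sym (length-aztecCells a b)) length≡n*3)) (m*n%n≡0 n 3)
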